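{- Let $D$ be an instance of Undirected Reachability Graph Realizability with solid graph $G$, and let $\mathrm{fes}$ be the feedback edge set number of $G$. In each minimal realization of $D$, each edge of $G$ receives $O(\mathrm{fes})$ labels.
   Context: An undirected temporal graph is a pair $(G,\lambda)$ with $G=(V,E)$ a simple undirected graph and $\lambda:E\to 2^{\mathbb{N}}$ assigning each edge a finite, possibly empty, set of labels. A strict (resp. non-strict) temporal path from $u$ to $v$ is a sequence $(e_1,t_1),\dots,(e_\ell,t_\ell)$, $t_j\in\lambda(e_j)$, such that $e_1,\dots,e_\ell$ form a $u$-$v$ path and $t_1<\dots<t_\ell$ (resp. $t_1\le\dots\le t_\ell$); the corresponding reachability graph is the digraph on $V$ with arc $(u,v)$, $u\ne v$, iff such a temporal path exists. Undirected Reachability Graph Realizability: given a simple digraph $D=(V,A)$, decide whether some undirected temporal graph on $V$ has (strict or non-strict, depending on the variant) reachability graph equal to $D$, possibly with restrictions on the labeling (arbitrary, simple, proper or happy). A solid edge of $D$ is a pair $\{u,v\}$ with $(u,v),(v,u)\in A$; the solid graph of $D$ is the undirected graph on $V$ formed by the solid edges; only solid edges can receive labels in a realization, so a realization is a labeling of the solid graph whose reachability graph is $D$. A realization $\lambda$ is minimal if for no edge $e$ can $\lambda(e)$ be replaced by a proper subset while still obtaining a realization. The feedback edge set number of a graph is the minimum number of edges whose removal makes it acyclic. -}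

module Defs where

open import Data.Nat using (ℕ; _<_; _≤_; _*_; _+_)
open import Data.Fin using (Fin)
open import Data.Fin.Properties using () renaming (_≟_ to _≟ᶠ_)
open import Data.Bool using (Bool; true; false)
open import Data.List using (List; []; _∷_; map; length)
open import Data.List.Membership.Propositional using (_∈_)
open import Data.List.Relation.Unary.Unique.Propositional using (Unique)
open import Data.Maybe using (Maybe; just; nothing)
open import Data.Product using (Σ; _×_; _,_; proj₁; ∃)
open import Data.Sum using (_⊎_)
open import Data.Unit using (⊤)
open import Relation.Nullary using (¬_; yes; no)
open import Relation.Binary.PropositionalEquality using (_≡_; _≢_)

Rel : ℕ → Set₁
Rel n = Fin n → Fin n → Set

SimpleDigraph : {n : ℕ} → Rel n → Set
SimpleDigraph {n} D = (u : Fin n) → ¬ D u u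

Solid : {n : ℕ} → Rel n → Rel n
Solid D u v = D u v × D v u

ChainTo : {n : ℕ} → Rel n → Fin n → List (Fin n) → Fin n → Set
ChainTo G x []       y = G x y
ChainTo G x (w ∷ ws) y = G x w × ChainTo G w ws y

HasCycle : {n : ℕ} → Rel n → Set
HasCycle {n} G =
  Σ (Fin n) λ v₀ → Σ (Fin n) λ v₁ → Σ (Fin n) λ v₂ → Σ (List (Fin n)) λ rest →
    Unique (v₀ ∷ v₁ ∷ v₂ ∷ rest) × G v₀ v₁ × ChainTo G v₁ (v₂ ∷ rest) v₀

Acyclic : {n : ℕ} → Rel n → Set
Acyclic G = ¬ HasCycle G

RemoveEdges : {n : ℕ} → Rel n → List (Fin n × Fin n) → Rel n
RemoveEdges G F u v = G u v × ¬ ((u , v) ∈ F) × ¬ ((v , u) ∈ F)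

IsFeedbackEdgeSetNumber : {n : ℕ} → Rel n → ℕ → Set
IsFeedbackEdgeSetNumber {n} G k =
  (Σ (List (Fin n × Fin n)) λ F → length F ≡ k × Acyclic (RemoveEdges G F))
  × ((F : List (Fin n × Fin n)) → Acyclic (RemoveEdges G F) → k ≤ length F)

-- A labeling assigns to each unordered pair {u,v} a finite set of labels,
-- represented by a duplicate-free list; the same list is used for both
-- orientations; loops carry no labels.
Labeling : ℕ → Set
Labeling n = Fin n → Fin n → List ℕ

WellFormedLabeling : {n : ℕ} → Labeling n → Set
WellFormedLabeling {n} λ′ =
  ((u v : Fin n) → λ′ u v ≡ λ′ v u)
  × ((u v : Fin n) → Unique (λ′ u v))
  × ((u : Fin n) → λ′ u u ≡ [])

TimeOk : Bool → Maybe ℕ → ℕ → Set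
TimeOk _     nothing  t = ⊤
TimeOk true  (just p) t = p < t
TimeOk false (just p) t = p ≤ t

ValidSteps : {n : ℕ} → Labeling n → Bool → Fin n → Maybe ℕ →
             List (Fin n × ℕ) → Fin n → Set
ValidSteps λ′ s cur prev []             v = cur ≡ v
ValidSteps λ′ s cur prev ((w , t) ∷ st) v =
  t ∈ λ′ cur w × TimeOk s prev t × ValidSteps λ′ s w (just t) st v

TemporalPath : {n : ℕ} → Labeling n → Bool → Fin n → Fin n → Set
TemporalPath {n} λ′ s u v =
  Σ (List (Fin n × ℕ)) λ st →
    ValidSteps λ′ s u nothing st v × Unique (u ∷ map proj₁ st)

Reach : {n : ℕ} → Labeling n → Bool → Rel n
Reach λ′ s u v = u ≢ v × TemporalPath λ′ s u v

Realizes : {n : ℕ} → Bool → Rel n → Labeling n → Set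
Realizes {n} s D λ′ = (u v : Fin n) → (D u v → Reach λ′ s u v) × (Reach λ′ s u v → D u v)

Replace : {n : ℕ} → Labeling n → Fin n → Fin n → List ℕ → Labeling n
Replace λ′ u v S x y with x ≟ᶠ u | y ≟ᶠ v | x ≟ᶠ v | y ≟ᶠ u
... | yes _ | yes _ | _     | _     = S
... | _     | _     | yes _ | yes _ = S
... | _     | _     | _     | _     = λ′ x y

ProperSubset : List ℕ → List ℕ → Set
ProperSubset S L = ((t : ℕ) → t ∈ S → t ∈ L) × ∃ λ t → t ∈ L × ¬ (t ∈ S)

MinimalRealization : {n : ℕ} → Bool → Rel n → Labeling n → Set
MinimalRealization {n} s D λ′ =
  WellFormedLabeling λ′ × Realizes s D λ′
  × ((u v : Fin n) → u ≢ v → (S : List ℕ) → ProperSubset S (λ′ u v) →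
      ¬ Realizes s D (Replace λ′ u v S))

{-# OPTIONS --safe #-}
module Submission where

-- Fix an edge {u , v}.  By minimality every label t of it is crossed by a temporal path whose
-- source cannot cross at any earlier label; consider the labels crossed in the direction u → v.
-- If t′ < t and the routes of t′ and t towards {u , v} meet in p, then the route of t reaches p too
-- late to continue along the route of t′.  Hence routes sharing an arc use it at increasing times.
-- Call an arc late for t if the routes of two smaller labels use it.  The first arc of the route of
-- t is not late, so unless no arc of it is late there are consecutive arcs (w , p), not late, and
-- (p , z), late because of t″ < t′ < t.  Then z can go to p with t″ and on to w with t, so w, p, z
-- is a triangle of the solid graph.  Every arc is chosen by at most two labels, and a graph in which
-- m edges lie in triangles has feedback edge set number Ω(m): every triangle has a removed side; a
-- removed side is in at most one triangle with two kept sides; and the kept edges joining ends of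
-- removed edges form a forest on few vertices.

open import Defs
open import Data.Bool using (Bool; true; false)
open import Data.Fin as Fin using (Fin)
import Data.Fin.Properties as Fin
open import Data.List using (List; []; _∷_; _++_; map; length; filter; deduplicate)
open import Data.List.Membership.Propositional using (_∈_)
open import Data.List.Membership.Propositional.Properties using (∈-++⁺ˡ; ∈-++⁺ʳ; ∈-map⁺; ∈-filter⁺; ∈-filter⁻; ∈-deduplicate⁻; ∈-deduplicate⁺)
open import Data.List.Properties using (length-map; length-++; filter-notAll)
open import Data.List.Relation.Unary.All as All using (All; []; _∷_)
import Data.List.Relation.Unary.All.Properties as All
open import Data.List.Relation.Unary.AllPairs using (AllPairs; []; _∷_)
import Data.List.Relation.Unary.AllPairs.Properties as AllPairs
open import Data.List.Relation.Unary.Any as Any using (Any; here; there)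
open import Data.List.Relation.Unary.Unique.Propositional using (Unique)
import Data.List.Relation.Unary.Unique.DecPropositional.Properties as DecUnique
open import Data.Maybe using (Maybe; just; nothing)
open import Data.Nat using (ℕ; zero; suc; _≤_; _<_; _*_; _+_; z≤n; s≤s)
open import Data.Nat.Properties
open import Data.Nat.Tactic.RingSolver using (solve-∀)
open import Data.Product using (Σ; _×_; _,_; proj₁; proj₂; ∃; swap)
open import Data.Product.Properties using (≡-dec)
open import Data.Sum using (_⊎_; inj₁; inj₂)
open import Data.Unit using (tt)
open import Function using (_∘_; id; _on_)
open import Relation.Binary using (DecidableEquality; tri<; tri≈; tri>)
open import Relation.Binary.Construct.Closure.ReflexiveTransitive using (Star; ε; _◅_; _◅◅_; reverse; gmap)
open import Relation.Binary.PropositionalEquality using (_≡_; _≢_; refl; sym; trans; cong; cong₂; subst; ≢-sym)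
open import Relation.Nullary using (¬_; Dec; yes; no; contradiction; ¬?)
open import Relation.Nullary.Decidable using (_⊎-dec_; _×-dec_; decidable-stable)
open import Relation.Unary using (Decidable)

-- Counting

length-filter-split : ∀ {A : Set} {P : A → Set} (P? : Decidable P) (xs : List A) →
  length xs ≡ length (filter P? xs) + length (filter (¬? ∘ P?) xs)
length-filter-split P? [] = refl
length-filter-split P? (x ∷ xs) with P? x
... | yes _ = cong suc (length-filter-split P? xs)
... | no  _ = trans (cong suc (length-filter-split P? xs)) (sym (+-suc _ _))

length≤split : ∀ {A : Set} {P : A → Set} (P? : Decidable P) (xs : List A) {a b : ℕ} →
  length (filter P? xs) ≤ a → length (filter (¬? ∘ P?) xs) ≤ b → length xs ≤ a + b
length≤split P? xs p q = ≤-trans (≤-reflexive (length-filter-split P? xs)) (+-mono-≤ p q)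

module _ {A : Set} (Dist : A → A → Set) where

  -- Sizes are measured by lists of pairwise `Dist` elements, so equality on `A` need not be
  -- decidable. In the application `A` consists of `Critical` witnesses and `Dist` says that their
  -- labels differ.
  FibresBounded : {B : Set} → (A → Set) → (A → B) → ℕ → Set
  FibresBounded Q f c = ∀ y zs → AllPairs Dist zs → All Q zs → All (λ z → f z ≡ y) zs → length zs ≤ c

  length≤fibres : {B : Set} (_≟_ : DecidableEquality B) {Q : A → Set} {f : A → B} {c : ℕ} →
    FibresBounded Q f c → (ys : List B) (xs : List A) →
    AllPairs Dist xs → All Q xs → All (λ x → f x ∈ ys) xs → length xs ≤ c * length ys
  length≤fibres _≟_ fib [] [] _ _ _ = z≤n
  length≤fibres _≟_ fib [] (x ∷ xs) _ _ (() ∷ _)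
  length≤fibres _≟_ {Q} {f} {c} fib (y ∷ ys) xs dist qs hits =
    subst (length xs ≤_) (sym (*-suc c (length ys)))
      (length≤split P? xs
        (fib y _ (AllPairs.filter⁺ P? dist) (All.filter⁺ P? qs) (All.all-filter P? xs))
        (length≤fibres _≟_ fib ys _ (AllPairs.filter⁺ (¬? ∘ P?) dist) (All.filter⁺ (¬? ∘ P?) qs)
          (All.map later (All.zip (All.filter⁺ (¬? ∘ P?) hits , All.all-filter (¬? ∘ P?) xs)))))
    where
    P? : Decidable (λ x → f x ≡ y)
    P? x = f x ≟ y
    later : ∀ {x} → f x ∈ y ∷ ys × f x ≢ y → f x ∈ ys
    later (here eq , ne) = contradiction eq ne
    later (there m , _)  = m

three-ordered : ∀ {A : Set} {P : A → Set} (f : A → ℕ) {a b c} → P a → P b → P c →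
  f a ≢ f b → f a ≢ f c → f b ≢ f c →
  ∃ λ j → ∃ λ k → ∃ λ i → P j × P k × P i × f j < f k × f k < f i
three-ordered f {a} {b} {c} pa pb pc ab ac bc with <-cmp (f a) (f b) | <-cmp (f b) (f c) | <-cmp (f a) (f c)
... | tri≈ _ eq _ | _           | _           = contradiction eq ab
... | _           | tri≈ _ eq _ | _           = contradiction eq bc
... | _           | _           | tri≈ _ eq _ = contradiction eq ac
... | tri< p _ _  | tri< q _ _  | _           = a , b , c , pa , pb , pc , p , q
... | tri< p _ _  | tri> _ _ q  | tri< r _ _  = a , c , b , pa , pc , pb , r , q
... | tri< p _ _  | tri> _ _ q  | tri> _ _ r  = c , a , b , pc , pa , pb , r , p
... | tri> _ _ p  | tri> _ _ q  | _           = c , b , a , pc , pb , pa , q , p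
... | tri> _ _ p  | tri< q _ _  | tri< r _ _  = b , a , c , pb , pa , pc , p , r
... | tri> _ _ p  | tri< q _ _  | tri> _ _ r  = b , c , a , pb , pc , pa , q , r

-- Triangles and feedback edge sets

module _ {n : ℕ} where

  _∈?_ : (x : Fin n) (xs : List (Fin n)) → Dec (x ∈ xs)
  x ∈? xs = Any.any? (x Fin.≟_) xs

  _≟²_ : DecidableEquality (Fin n × Fin n)
  _≟²_ = ≡-dec Fin._≟_ Fin._≟_

  cutChain : ∀ {G : Rel n} {x y w} (ws : List (Fin n)) → x ∈ w ∷ ws → ChainTo G w ws y →
    Unique (y ∷ w ∷ ws) → Σ (List (Fin n)) λ ws′ → ChainTo G x ws′ y × Unique (y ∷ x ∷ ws′)
  cutChain ws (here refl) ch un = ws , ch , un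
  cutChain [] (there ()) ch un
  cutChain (w′ ∷ ws) (there m) (_ , ch) ((_ ∷ y∉) ∷ (_ ∷ un)) = cutChain ws m ch (y∉ ∷ un)

  -- Loop erasure. The target `y` heads the uniqueness list because an edge from `y` back to `x`
  -- then closes a cycle in the shape of `HasCycle`.
  star⇒simpleChain : ∀ {G : Rel n} {x y} → Star G x y → x ≢ y →
    Σ (List (Fin n)) λ ws → ChainTo G x ws y × Unique (y ∷ x ∷ ws)
  star⇒simpleChain ε x≢y = contradiction refl x≢y
  star⇒simpleChain {x = x} {y} (_◅_ {j = w} g st) x≢y with w Fin.≟ y
  ... | yes refl = [] , g , ((≢-sym x≢y ∷ []) ∷ [] ∷ [])
  ... | no w≢y with star⇒simpleChain st w≢y
  ...   | ws , ch , un@(y∉ ∷ un′) with x ∈? (w ∷ ws)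
  ...     | yes m  = cutChain ws m ch un
  ...     | no x∉ = w ∷ ws , (g , ch) , (≢-sym x≢y ∷ y∉) ∷ All.¬Any⇒All¬ _ x∉ ∷ un′

  ListAdj : List (Fin n × Fin n) → Rel n
  ListAdj L x y = (x , y) ∈ L ⊎ (y , x) ∈ L

  ListAdj-sym : ∀ {L x y} → ListAdj L x y → ListAdj L y x
  ListAdj-sym (inj₁ m) = inj₂ m
  ListAdj-sym (inj₂ m) = inj₁ m

  ListAdj-there : ∀ {L e x y} → ListAdj L x y → ListAdj (e ∷ L) x y
  ListAdj-there (inj₁ m) = inj₁ (there m)
  ListAdj-there (inj₂ m) = inj₂ (there m)

  mapChain : ∀ {G H : Rel n} → (∀ {x y} → G x y → H x y) →
    ∀ {x y} ws → ChainTo G x ws y → ChainTo H x ws y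
  mapChain f [] g = f g
  mapChain f (w ∷ ws) (g , ch) = f g , mapChain f ws ch

  module _ {G : Rel n} (G-sym : ∀ {x y} → G x y → G y x) (acyclic : Acyclic G) where

    -- A union-find structure: `root` names the component of a vertex, and `roots` contains the
    -- names in use on `S`; every edge of a forest merges two components.
    record Components (S : List (Fin n)) (L : List (Fin n × Fin n)) : Set where
      field
        root      : Fin n → Fin n
        roots     : List (Fin n)
        complete  : ∀ {x} → x ∈ S → root x ∈ roots
        connected : ∀ {x y} → root x ≡ root y → Star (ListAdj L) x y
        count     : length L + length roots ≤ length S

    -- The orientation `x < y` admits one pair per undirected edge, so that `Unique` lists count
    -- undirected edges.
    ForestEdge : List (Fin n) → Fin n × Fin n → Set
    ForestEdge S (x , y) = x Fin.< y × G x y × x ∈ S × y ∈ S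

    -- If the ends of the new edge had the same root, a path in `L` between them would close a
    -- cycle. Otherwise the root of `a` is renamed to that of `b` and leaves `roots`, which pays for
    -- the new edge.
    components : ∀ {S} L → Unique L → All (ForestEdge S) L → Components S L
    components {S} [] _ _ = record
      { root = id ; roots = S ; complete = id
      ; connected = λ { refl → ε } ; count = ≤-refl }
    components {S} ((a , b) ∷ L) (new ∷ un) ((a<b , gab , a∈S , b∈S) ∷ forest)
      with components L un forest
    ... | C with Components.root C a Fin.≟ Components.root C b
    ...   | yes same = contradiction (close (star⇒simpleChain (connected same) a≢b)) acyclic
      where
      open Components C
      a≢b : a ≢ b
      a≢b refl = Fin.<-irrefl refl a<b
      adj⇒G : ∀ {x y} → ListAdj L x y → G x y
      adj⇒G (inj₁ m) = proj₁ (proj₂ (All.lookup forest m))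
      adj⇒G (inj₂ m) = G-sym (proj₁ (proj₂ (All.lookup forest m)))
      close : (Σ (List (Fin n)) λ ws → ChainTo (ListAdj L) a ws b × Unique (b ∷ a ∷ ws)) → HasCycle G
      -- A path of a single edge would be `(a , b)` itself or its reverse, excluded by `Unique` and
      -- by the orientation. The cycle thus has at least three vertices.
      close ([] , inj₁ m , _) = contradiction refl (All.lookup new m)
      close ([] , inj₂ m , _) = contradiction (proj₁ (All.lookup forest m)) (Fin.<-asym a<b)
      close (w ∷ ws , ch , un) = b , a , w , ws , un , G-sym gab , mapChain adj⇒G (w ∷ ws) ch
    ...   | no apart = record
      { root = root′ ; roots = filter P? roots ; complete = complete′
      ; connected = connected′
      ; count = ≤-trans (≤-reflexive (sym (+-suc (length L) _)))
                  (≤-trans (+-monoʳ-≤ (length L) (filter-notAll P? roots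
                    (Any.map (λ eq ne → ne (sym eq)) (complete a∈S)))) count) }
      where
      open Components C
      P? : Decidable (λ r → r ≢ root a)
      P? r = ¬? (r Fin.≟ root a)
      root′ : Fin n → Fin n
      root′ x with root x Fin.≟ root a
      ... | yes _ = root b
      ... | no  _ = root x
      complete′ : ∀ {x} → x ∈ S → root′ x ∈ filter P? roots
      complete′ {x} x∈S with root x Fin.≟ root a
      ... | yes _  = ∈-filter⁺ P? (complete b∈S) (≢-sym apart)
      ... | no ne = ∈-filter⁺ P? (complete x∈S) ne
      old : ∀ {x y} → root x ≡ root y → Star (ListAdj ((a , b) ∷ L)) x y
      old eq = gmap id ListAdj-there (connected eq)
      bridge : ∀ {x y} → root x ≡ root a → root b ≡ root y → Star (ListAdj ((a , b) ∷ L)) x y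
      bridge p q = old p ◅◅ inj₁ (here refl) ◅ old q
      connected′ : ∀ {x y} → root′ x ≡ root′ y → Star (ListAdj ((a , b) ∷ L)) x y
      connected′ {x} {y} eq with root x Fin.≟ root a | root y Fin.≟ root a
      ... | yes p | yes q = old (trans p (sym q))
      ... | yes p | no  _ = bridge p eq
      ... | no  _ | yes q = reverse ListAdj-sym (bridge q (sym eq))
      ... | no  _ | no  _ = old eq

    forest-length : ∀ {S} L → Unique L → All (ForestEdge S) L → length L ≤ length S
    forest-length L un forest = ≤-trans (m≤m+n (length L) _) (Components.count (components L un forest))

  module Triangles (G : Rel n) (G-sym : ∀ {x y} → G x y → G y x) (G-irrefl : ∀ {x} → ¬ G x x)
    (F : List (Fin n × Fin n)) (acyclic : Acyclic (RemoveEdges G F)) where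

    Removed : Rel n
    Removed = ListAdj F

    removed? : ∀ x y → Dec (Removed x y)
    removed? x y = Any.any? ((x , y) ≟²_) F ⊎-dec Any.any? ((y , x) ≟²_) F

    Kept : Rel n
    Kept = RemoveEdges G F

    kept : ∀ {x y} → G x y → ¬ Removed x y → Kept x y
    kept g nr = g , nr ∘ inj₁ , nr ∘ inj₂

    Kept-sym : ∀ {x y} → Kept x y → Kept y x
    Kept-sym (g , p , q) = G-sym g , q , p

    G⇒≢ : ∀ {x y} → G x y → x ≢ y
    G⇒≢ g refl = G-irrefl g

    F± : List (Fin n × Fin n)
    F± = F ++ map swap F

    removed⇒∈F± : ∀ {x y} → Removed x y → (x , y) ∈ F±
    removed⇒∈F± (inj₁ m) = ∈-++⁺ˡ m
    removed⇒∈F± (inj₂ m) = ∈-++⁺ʳ F (∈-map⁺ swap m)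

    length-F± : length F± ≡ 2 * length F
    length-F± = trans (length-++ F) (cong (length F +_) (trans (length-map swap F) (sym (+-identityʳ _))))

    ends : List (Fin n)
    ends = map proj₁ F ++ map proj₂ F

    length-ends : length ends ≡ 2 * length F
    length-ends = trans (length-++ (map proj₁ F))
      (cong₂ _+_ (length-map proj₁ F) (trans (length-map proj₂ F) (sym (+-identityʳ _))))

    removed⇒∈ends : ∀ {x y} → Removed x y → x ∈ ends
    removed⇒∈ends (inj₁ m) = ∈-++⁺ˡ (∈-map⁺ proj₁ m)
    removed⇒∈ends (inj₂ m) = ∈-++⁺ʳ (map proj₁ F) (∈-map⁺ proj₂ m)

    -- Otherwise `w`, `p`, `w′`, `z` form a 4-cycle of kept edges.
    no-square : ∀ {w w′ p z} → Kept w p → Kept w z → Kept w′ p → Kept w′ z → p ≢ z → w ≡ w′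
    no-square {w} {w′} {p} {z} wp wz w′p w′z p≢z with w Fin.≟ w′
    ... | yes eq = eq
    ... | no ne = contradiction
      (w , p , w′ , z ∷ [] ,
        (G⇒≢ (proj₁ wp) ∷ ne ∷ G⇒≢ (proj₁ wz) ∷ []) ∷ (≢-sym (G⇒≢ (proj₁ w′p)) ∷ p≢z ∷ [])
          ∷ (G⇒≢ (proj₁ w′z) ∷ []) ∷ [] ∷ [] ,
        wp , Kept-sym w′p , w′z , Kept-sym wz) acyclic

    Triangle : Fin n → Fin n → Fin n → Set
    Triangle x y z = G x y × G x z × G y z

    module _ {A : Set} (Dist : A → A → Set) where

      Tagged : (A → Set) → (A → Fin n) → (A → Fin n) → (A → Fin n) → A → Set
      Tagged Q x y z a = Q a × Triangle (x a) (y a) (z a)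

      -- The apex x is determined by the removed side {y , z}: two of them would span a 4-cycle.
      apex-length : (Q : A → Set) (x y z : A → Fin n) {c : ℕ} →
        FibresBounded Dist Q (λ a → x a , y a) c → ∀ xs → AllPairs Dist xs → All (Tagged Q x y z) xs →
        All (λ a → Kept (x a) (y a) × Kept (x a) (z a)) xs →
        All (λ a → Removed (y a) (z a)) xs → length xs ≤ c * (2 * length F)
      apex-length Q x y z {c} fib xs dist qs ks rs = subst (λ m → length xs ≤ c * m) length-F±
        (length≤fibres Dist _≟²_ {Q = Q′} {f = λ a → y a , z a} fib′ F± xs dist
          (All.zip (qs , ks)) (All.map removed⇒∈F± rs))
        where
        Q′ : A → Set
        Q′ a = Tagged Q x y z a × Kept (x a) (y a) × Kept (x a) (z a)
        same : ∀ {a b e} → Q′ a → (y a , z a) ≡ e → Q′ b → (y b , z b) ≡ e → (x b , y b) ≡ (x a , y a)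
        same {a} {b} ((_ , _ , _ , yz) , xy , xz) refl (_ , xy′ , xz′) eq
          with y b | z b | eq
        ... | _ | _ | refl = cong (_, y a) (no-square xy′ xz′ xy xz (G⇒≢ yz))
        fib′ : FibresBounded Dist Q′ (λ a → y a , z a) c
        fib′ e [] _ _ _ = z≤n
        -- With the apex determined, all elements over one removed side share the pair
        -- `(x a , y a)`, so the bound `c` applies to them.
        fib′ e (a ∷ zs) d (q ∷ qs) (eq ∷ eqs) = fib (x a , y a) (a ∷ zs) d
          (proj₁ (proj₁ q) ∷ All.map (proj₁ ∘ proj₁) qs)
          (refl ∷ All.map (λ { (q′ , eq′) → same q eq q′ eq′ }) (All.zip (qs , eqs)))

      -- The distinct edges form a forest on the ends of removed edges, hence number at most
      -- `2 * length F`; each is shared by at most `c` elements.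
      ends-length : (Q : A → Set) (x y : A → Fin n) {c : ℕ} →
        FibresBounded Dist Q (λ a → x a , y a) c → ∀ xs → AllPairs Dist xs → All Q xs →
        All (λ a → ForestEdge {G = Kept} Kept-sym acyclic ends (x a , y a)) xs →
        length xs ≤ c * (2 * length F)
      ends-length Q x y {c} fib xs dist qs es = ≤-trans
        (length≤fibres Dist _≟²_ fib L xs dist qs
          (All.tabulate (λ m → ∈-deduplicate⁺ _≟²_ (∈-map⁺ edge m))))
        (*-monoʳ-≤ c (≤-trans
          (forest-length Kept-sym acyclic L (DecUnique.deduplicate-! _≟²_ (map edge xs))
            (All.tabulate (λ m → All.lookup (All.map⁺ es) (∈-deduplicate⁻ _≟²_ (map edge xs) m))))
          (≤-reflexive length-ends)))
        where
        edge : A → Fin n × Fin n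
        edge a = x a , y a
        L : List (Fin n × Fin n)
        L = deduplicate _≟²_ (map edge xs)

      -- Five batches of at most `c * (2 * length F)` elements each: `xy` removed; only `yz` removed
      -- (apex `x`); only `xz` removed (apex `y`); and only `xy` kept, so that `x` and `y` are both
      -- ends of removed edges, once for each order of `x` and `y`.
      triangle-length : (Q : A → Set) (x y z : A → Fin n) {c : ℕ} →
        FibresBounded Dist Q (λ a → x a , y a) c → ∀ xs → AllPairs Dist xs → All (Tagged Q x y z) xs →
        length xs ≤ c * (10 * length F)
      triangle-length Q x y z {c} fib xs dist qs =
        subst (length xs ≤_) (arith c (length F))
          (length≤split xy? xs
            (subst (λ m → length (filter xy? xs) ≤ c * m) length-F±
              (length≤fibres Dist _≟²_ fib F± _ (AllPairs.filter⁺ xy? dist)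
                (All.map proj₁ (All.filter⁺ xy? qs)) (All.map removed⇒∈F± (All.all-filter xy? xs))))
            (rest (AllPairs.filter⁺ (¬? ∘ xy?) dist)
              (All.zip (All.filter⁺ (¬? ∘ xy?) qs , All.all-filter (¬? ∘ xy?) xs))))
        where
        b : ℕ
        b = c * (2 * length F)
        arith : ∀ c k → c * (2 * k) + (c * (2 * k) + c * (2 * k) + c * (2 * k) + c * (2 * k)) ≡ c * (10 * k)
        arith = solve-∀
        xy? : Decidable (λ a → Removed (x a) (y a))
        xy? a = removed? (x a) (y a)
        xz? : Decidable (λ a → Removed (x a) (z a))
        xz? a = removed? (x a) (z a)
        yz? : Decidable (λ a → Removed (y a) (z a))
        yz? a = removed? (y a) (z a)
        x<y? : Decidable (λ a → x a Fin.< y a)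
        x<y? a = x a Fin.<? y a
        K : A → Set
        K a = Tagged Q x y z a × ¬ Removed (x a) (y a)
        K-kept : ∀ {a} → K a → Kept (x a) (y a)
        K-kept ((_ , g , _) , nr) = kept g nr
        swapped : FibresBounded Dist Q (λ a → y a , x a) c
        swapped e zs d q eqs = fib (swap e) zs d q (All.map (cong swap) eqs)
        close : ∀ {a} → Kept (x a) (y a) → Kept (x a) (z a) → Tagged Q x y z a → Removed (y a) (z a)
        close {a} xy xz (_ , g , g′ , g″) with removed? (y a) (z a)
        ... | yes r = r
        ... | no nr = contradiction
          (x a , y a , z a , [] ,
            (G⇒≢ g ∷ G⇒≢ g′ ∷ []) ∷ (G⇒≢ g″ ∷ []) ∷ [] ∷ [] ,
            xy , kept g″ nr , Kept-sym xz) acyclic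
        tagged-swap : ∀ {a} → Tagged Q x y z a → Tagged Q y x z a
        tagged-swap (q , g , g′ , g″) = q , G-sym g , g″ , g′
        rest₃ : ∀ {zs} → AllPairs Dist zs → All (λ a → (K a × Removed (x a) (z a)) × Removed (y a) (z a)) zs →
          length zs ≤ b + b
        rest₃ {zs} d ps = length≤split x<y? zs
          (ends-length Q x y fib _ (AllPairs.filter⁺ x<y? d)
            (All.map (proj₁ ∘ proj₁ ∘ proj₁ ∘ proj₁) (All.filter⁺ x<y? ps))
            (All.map (λ { (((k , r) , r′) , lt) → lt , K-kept k , removed⇒∈ends r , removed⇒∈ends r′ })
              (All.zip (All.filter⁺ x<y? ps , All.all-filter x<y? zs))))
          (ends-length Q y x swapped _ (AllPairs.filter⁺ (¬? ∘ x<y?) d)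
            (All.map (proj₁ ∘ proj₁ ∘ proj₁ ∘ proj₁) (All.filter⁺ (¬? ∘ x<y?) ps))
            (All.map (λ { (((k@((_ , g , _) , _) , r) , r′) , nlt) →
                Fin.≤∧≢⇒< (≮⇒≥ nlt) (≢-sym (G⇒≢ g)) ,
                Kept-sym (K-kept k) , removed⇒∈ends r′ , removed⇒∈ends r })
              (All.zip (All.filter⁺ (¬? ∘ x<y?) ps , All.all-filter (¬? ∘ x<y?) zs))))
        rest₂ : ∀ {zs} → AllPairs Dist zs → All (λ a → K a × Removed (x a) (z a)) zs →
          length zs ≤ b + b + b
        rest₂ {zs} d ps = length≤split yz? zs
          (rest₃ (AllPairs.filter⁺ yz? d) (All.zip (All.filter⁺ yz? ps , All.all-filter yz? zs)))
          (apex-length Q y x z swapped _ (AllPairs.filter⁺ (¬? ∘ yz?) d)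
            (All.map (λ { ((k , _) , _) → tagged-swap (proj₁ k) }) ps′)
            (All.map (λ { ((k@((_ , _ , _ , g) , _) , _) , nr) → Kept-sym (K-kept k) , kept g nr }) ps′)
            (All.map (proj₂ ∘ proj₁) ps′))
          where ps′ = All.zip (All.filter⁺ (¬? ∘ yz?) ps , All.all-filter (¬? ∘ yz?) zs)
        rest : ∀ {zs} → AllPairs Dist zs → All K zs →
          length zs ≤ b + b + b + b
        rest {zs} d ks = length≤split xz? zs
          (rest₂ (AllPairs.filter⁺ xz? d) (All.zip (All.filter⁺ xz? ks , All.all-filter xz? zs)))
          (apex-length Q x y z fib _ (AllPairs.filter⁺ (¬? ∘ xz?) d)
            (All.map (λ { (k , _) → proj₁ k }) ks′)
            (All.map both ks′)
            (All.map (λ { kp@(k , _) → close (proj₁ (both kp)) (proj₂ (both kp)) (proj₁ k) }) ks′))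
          where
          ks′ = All.zip (All.filter⁺ (¬? ∘ xz?) ks , All.all-filter (¬? ∘ xz?) zs)
          both : ∀ {a} → K a × ¬ Removed (x a) (z a) → Kept (x a) (y a) × Kept (x a) (z a)
          both (k@((_ , _ , g , _) , _) , nr) = K-kept k , kept g nr

-- Temporal walks

-- Arrival times are compared by the departures they permit, which treats `nothing` and both notions
-- of path uniformly.
Earlier : Bool → Maybe ℕ → Maybe ℕ → Set
Earlier s p q = ∀ {t} → TimeOk s q t → TimeOk s p t

TimeOk-≤ : ∀ s p {t t′} → TimeOk s p t → t ≤ t′ → TimeOk s p t′
TimeOk-≤ s     nothing  _  _  = tt
TimeOk-≤ true  (just p) ok le = ≤-trans ok le
TimeOk-≤ false (just p) ok le = ≤-trans ok le

TimeOk⇒≤ : ∀ s {p t} → TimeOk s (just p) t → p ≤ t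
TimeOk⇒≤ true  ok = <⇒≤ ok
TimeOk⇒≤ false ok = ok

<⇒TimeOk : ∀ s {p t} → p < t → TimeOk s (just p) t
<⇒TimeOk true  lt = lt
<⇒TimeOk false lt = <⇒≤ lt

¬TimeOk⇒≥ : ∀ s {p t} → ¬ TimeOk s (just p) t → t ≤ p
¬TimeOk⇒≥ true  nok = ≮⇒≥ nok
¬TimeOk⇒≥ false nok = ≰⇒≥ nok

TimeOk⇒Earlier : ∀ s p {t} → TimeOk s p t → Earlier s p (just t)
TimeOk⇒Earlier s p ok ok′ = TimeOk-≤ s p ok (TimeOk⇒≤ s ok′)

≤⇒Earlier : ∀ s {t t′} → t ≤ t′ → Earlier s (just t) (just t′)
≤⇒Earlier true  le ok = ≤-<-trans le ok
≤⇒Earlier false le ok = ≤-trans le ok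

TimedRel : ℕ → Set₁
TimedRel n = Fin n → Fin n → ℕ → Set

Labelled : ∀ {n} → Labeling n → TimedRel n
Labelled λ′ x y t = t ∈ λ′ x y

Within : ∀ {n} → TimedRel n → (Fin n → Set) → TimedRel n
Within E P x y t = E x y t × P x × P y

-- The second and the last index are the times of arrival at the two end vertices.
data Walk {n : ℕ} (E : TimedRel n) (s : Bool) : Fin n → Maybe ℕ → Fin n → Maybe ℕ → Set where
  []   : ∀ {x p} → Walk E s x p x p
  step : ∀ {x y z p q t} → E x y t → TimeOk s p t → Walk E s y (just t) z q → Walk E s x p z q

module _ {n : ℕ} {s : Bool} where

  module _ {E : TimedRel n} where

    verts : ∀ {x p y q} → Walk E s x p y q → List (Fin n)
    verts {x} []           = x ∷ []
    verts {x} (step _ _ W) = x ∷ verts W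

    edges : ∀ {x p y q} → Walk E s x p y q → List (Fin n × Fin n)
    edges []                       = []
    edges {x} (step {y = y} _ _ W) = (x , y) ∷ edges W

    infixr 5 _++ʷ_
    _++ʷ_ : ∀ {x p y q z r} → Walk E s x p y q → Walk E s y q z r → Walk E s x p z r
    []          ++ʷ W′ = W′
    step e ok W ++ʷ W′ = step e ok (W ++ʷ W′)

    start∈verts : ∀ {x p y q} (W : Walk E s x p y q) → x ∈ verts W
    start∈verts []           = here refl
    start∈verts (step _ _ _) = here refl

    end∈verts : ∀ {x p y q} (W : Walk E s x p y q) → y ∈ verts W
    end∈verts []           = here refl
    end∈verts (step _ _ W) = there (end∈verts W)

    -- Only the first step sees the initial time. The final time is existential because it changes
    -- when the walk is empty.
    depart-earlier : ∀ {x p p′ y q} → Earlier s p′ p → (W : Walk E s x p y q) →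
      ∃ λ q′ → Σ (Walk E s x p′ y q′) λ W′ → verts W′ ≡ verts W
    depart-earlier earlier []            = _ , [] , refl
    depart-earlier earlier (step e ok W) = _ , step e (earlier ok) W , refl

    cut : ∀ {x y p z q} (W : Walk E s y p z q) → Unique (verts W) → x ∈ verts W →
      ∃ λ p′ → Earlier s p p′ × Σ (Walk E s x p′ z q) λ W′ → Unique (verts W′)
    cut []              un       (here refl) = _ , id , [] , un
    cut W@(step _ _ _)  un       (here refl) = _ , id , W , un
    cut {p = p} (step e ok W) (_ ∷ un) (there m) with cut W un m
    ... | p′ , earlier , W′ , un′ = p′ , TimeOk⇒Earlier s p ok ∘ earlier , W′ , un′

    -- When the start vertex reappears, the loop is dropped: the remainder leaves after the loop,
    -- hence at a time that is also permitted at the start.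
    simplify : ∀ {x p y q} → Walk E s x p y q → ∃ λ q′ → Σ (Walk E s x p y q′) λ W → Unique (verts W)
    simplify [] = _ , [] , [] ∷ []
    simplify {x} {p} (step e ok W) with simplify W
    ... | q′ , W′ , un with x ∈? verts W′
    ...   | no x∉ = q′ , step e ok W′ , All.¬Any⇒All¬ _ x∉ ∷ un
    ...   | yes x∈ with cut W′ un x∈
    ...     | p′ , earlier , W″ , un″ with depart-earlier (TimeOk⇒Earlier s p ok ∘ earlier) W″
    ...       | q″ , W‴ , eq = q″ , W‴ , subst Unique (sym eq) un″

  mapWalk : ∀ {E E′ : TimedRel n} → (∀ {x y t} → E x y t → E′ x y t) →
    ∀ {x p y q} → Walk E s x p y q → Walk E′ s x p y q
  mapWalk f []            = []
  mapWalk f (step e ok W) = step (f e) ok (mapWalk f W)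

  restrict : ∀ {E : TimedRel n} {P : Fin n → Set} {x p y q} (W : Walk E s x p y q) → All P (verts W) →
    Σ (Walk (Within E P) s x p y q) λ W′ → verts W′ ≡ verts W
  restrict [] _ = [] , refl
  restrict {x = x} (step e ok W) (px ∷ ps) with restrict W ps
  ... | W′ , eq = step (e , px , All.lookup ps (start∈verts W)) ok W′ , cong (x ∷_) eq

  module _ {λ′ : Labeling n} where

    steps⇒walk : ∀ {x p y} st → ValidSteps λ′ s x p st y →
      ∃ λ q → Σ (Walk (Labelled λ′) s x p y q) λ W → verts W ≡ x ∷ map proj₁ st
    steps⇒walk [] refl = _ , [] , refl
    steps⇒walk ((w , t) ∷ st) (m , ok , valid) with steps⇒walk st valid
    ... | q , W , eq = q , step m ok W , cong (_ ∷_) eq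

    walk⇒steps : ∀ {x p y q} (W : Walk (Labelled λ′) s x p y q) →
      Σ (List (Fin n × ℕ)) λ st → ValidSteps λ′ s x p st y × verts W ≡ x ∷ map proj₁ st
    walk⇒steps [] = [] , refl , refl
    walk⇒steps (step {y = y} {t = t} m ok W) with walk⇒steps W
    ... | st , valid , eq = (y , t) ∷ st , (m , ok , valid) , cong (_ ∷_) eq

    -- Repeated vertices are removed only here, so walks can be concatenated freely everywhere else.
    walk⇒reach : ∀ {x y q} → x ≢ y → Walk (Labelled λ′) s x nothing y q → Reach λ′ s x y
    walk⇒reach x≢y W with simplify W
    ... | _ , W′ , un with walk⇒steps W′
    ...   | st , valid , eq = x≢y , st , valid , subst Unique eq un

unique-++⁻ : ∀ {A : Set} (xs : List A) {ys} → Unique (xs ++ ys) →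
  Unique xs × (∀ {x y} → x ∈ xs → y ∈ ys → x ≢ y)
unique-++⁻ [] _ = [] , λ ()
unique-++⁻ (x ∷ xs) (x∉ ∷ un) with unique-++⁻ xs un
... | un′ , apart = All.++⁻ˡ xs x∉ ∷ un′ , λ
  { (here refl) y∈ → All.lookup (All.++⁻ʳ xs x∉) y∈
  ; (there x∈)  y∈ → apart x∈ y∈ }

-- Replacing the labels of one edge

module _ {n : ℕ} (λ′ : Labeling n) (u v : Fin n) (S : List ℕ) where

  ∈-Replace⁺ : ∀ {x y t} → t ∈ λ′ x y → (x ≡ u → y ≡ v → t ∈ S) → (x ≡ v → y ≡ u → t ∈ S) →
    t ∈ Replace λ′ u v S x y
  ∈-Replace⁺ {x} {y} m f g with x Fin.≟ u | y Fin.≟ v | x Fin.≟ v | y Fin.≟ u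
  ... | yes p | yes q | _     | _     = f p q
  ... | no _  | _     | yes p | yes q = g p q
  ... | yes _ | no _  | yes p | yes q = g p q
  ... | no _  | _     | no _  | _     = m
  ... | no _  | _     | yes _ | no _  = m
  ... | yes _ | no _  | no _  | _     = m
  ... | yes _ | no _  | yes _ | no _  = m

  ∈-Replace⁻ : (∀ {t} → t ∈ S → t ∈ λ′ u v) → λ′ u v ≡ λ′ v u →
    ∀ {x y t} → t ∈ Replace λ′ u v S x y → t ∈ λ′ x y
  ∈-Replace⁻ S⊆ eq {x} {y} {t} m with x Fin.≟ u | y Fin.≟ v | x Fin.≟ v | y Fin.≟ u
  ... | yes refl | yes refl | _        | _        = S⊆ m
  ... | no _     | _        | yes refl | yes refl = subst (t ∈_) eq (S⊆ m)
  ... | yes _    | no _     | yes refl | yes refl = subst (t ∈_) eq (S⊆ m)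
  ... | no _     | _        | no _     | _        = m
  ... | no _     | _        | yes _    | no _     = m
  ... | yes _    | no _     | no _     | _        = m
  ... | yes _    | no _     | yes _    | no _     = m

-- Critical labels

module _ {n : ℕ} (λ′ : Labeling n) where

  -- Such a walk can enter `v` only from `u` at time `t`, so it survives the deletion of any other
  -- label of the edge.
  Via : Fin n → Fin n → ℕ → TimedRel n
  Via u v t x y t′ = Within (Labelled λ′) (_≢ v) x y t′ ⊎ (x ≡ u × y ≡ v × t′ ≡ t)

module _ {n : ℕ} (λ′ : Labeling n) (s : Bool) where

  -- Witnesses that a label of {u , v} is indispensable in the direction u → v: `source` catches
  -- the edge at time `label`, but at no earlier label.
  record Critical (u v : Fin n) : Set where
    field
      label     : ℕ
      labelled  : label ∈ λ′ u v
      source    : Fin n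
      arrival   : Maybe ℕ
      front     : Walk (Within (Labelled λ′) (_≢ v)) s source nothing u arrival
      inTime    : TimeOk s arrival label
      simple    : Unique (verts front)
      noEarlier : ∀ {t} → t < label → t ∈ λ′ u v → ¬ Walk (Via λ′ u v t) s source nothing v (just t)

  record Split (u v : Fin n) (t : ℕ) {x p y q} (W : Walk (Labelled λ′) s x p y q) : Set where
    field
      {arrival} : Maybe ℕ
      labelled  : t ∈ λ′ u v
      before    : Walk (Labelled λ′) s x p u arrival
      inTime    : TimeOk s arrival t
      after     : Walk (Labelled λ′) s v (just t) y q
      verts≡    : verts W ≡ verts before ++ verts after

  split-step : ∀ {u v t x y z p q r} (m : r ∈ λ′ x y) (ok : TimeOk s p r) {W : Walk (Labelled λ′) s y (just r) z q} →
    Split u v t W → Split u v t (step m ok W)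
  split-step {x = x} m ok σ = record
    { labelled = labelled ; before = step m ok before ; inTime = inTime ; after = after
    ; verts≡ = cong (x ∷_) verts≡ }
    where open Split σ

  Survives : Labeling n → Fin n → Fin n → ℕ → Set
  Survives μ u v t = ∀ {x y r} → r ∈ λ′ x y → (x ≡ u → y ≡ v → r ≢ t) → (x ≡ v → y ≡ u → r ≢ t) → r ∈ μ x y

  split-or-survive : ∀ {μ u v t} → Survives μ u v t → ∀ {x p y q} (W : Walk (Labelled λ′) s x p y q) →
    Walk (Labelled μ) s x p y q ⊎ Split u v t W ⊎ Split v u t W
  split-or-survive sur [] = inj₁ []
  split-or-survive {u = u} {v} {t} sur {x} (step {y = y} {t = r} m ok W)
    with (x Fin.≟ u) ×-dec (y Fin.≟ v) ×-dec (r ≟ t) | (x Fin.≟ v) ×-dec (y Fin.≟ u) ×-dec (r ≟ t)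
  ... | yes (refl , refl , refl) | _ = inj₂ (inj₁ (record
    { labelled = m ; before = [] ; inTime = ok ; after = W ; verts≡ = refl }))
  ... | no _ | yes (refl , refl , refl) = inj₂ (inj₂ (record
    { labelled = m ; before = [] ; inTime = ok ; after = W ; verts≡ = refl }))
  ... | no ne | no ne′ with split-or-survive sur W
  ...   | inj₁ W′ = inj₁ (step (sur m (λ p q eq → ne (p , q , eq)) (λ p q eq → ne′ (p , q , eq))) ok W′)
  ...   | inj₂ (inj₁ σ) = inj₂ (inj₁ (split-step m ok σ))
  ...   | inj₂ (inj₂ σ) = inj₂ (inj₂ (split-step m ok σ))

  -- As `W` is simple, it avoids `v` before the crossing and `u` after it. A source that could cross
  -- at a smaller label would wait at `v` and follow the rest of `W`, never using `t` on the edge;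
  -- it would then reach the target in `μ` as well.
  split⇒critical : ∀ {μ u v t} → Survives μ u v t → ∀ {a b q} (W : Walk (Labelled λ′) s a nothing b q) →
    Unique (verts W) → (∀ {q′} → ¬ Walk (Labelled μ) s a nothing b q′) → Split u v t W →
    Σ (Critical u v) λ i → Critical.label i ≡ t
  split⇒critical {μ} {u} {v} {t} sur {a} W un none σ = record
    { label = t ; labelled = labelled ; source = a ; arrival = arrival
    ; front = proj₁ front ; inTime = inTime ; simple = subst Unique (sym (proj₂ front)) (proj₁ parts)
    ; noEarlier = λ lt m W′ →
        none (mapWalk (survive lt m) W′
          ++ʷ mapWalk after-survives (proj₁ (proj₂ (depart-earlier (≤⇒Earlier s (<⇒≤ lt)) (proj₁ rear)))))
    } , refl
    where
    open Split σ
    parts = unique-++⁻ (verts before) (subst Unique verts≡ un)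
    front = restrict {P = _≢ v} before
      (All.tabulate (λ x∈ → proj₂ parts x∈ (start∈verts after)))
    rear = restrict {P = _≢ u} after
      (All.tabulate (λ y∈ → ≢-sym (proj₂ parts (end∈verts before) y∈)))
    survive : ∀ {t′} → t′ < t → t′ ∈ λ′ u v → ∀ {x y r} → Via λ′ u v t′ x y r → r ∈ μ x y
    survive lt m (inj₁ (m′ , x≢v , y≢v)) = sur m′ (λ _ eq → contradiction eq y≢v) (λ eq → contradiction eq x≢v)
    survive lt m (inj₂ (refl , refl , refl)) = sur m (λ _ _ → <⇒≢ lt) (λ _ _ → <⇒≢ lt)
    after-survives : ∀ {x y r} → Within (Labelled λ′) (_≢ u) x y r → r ∈ μ x y
    after-survives (m , x≢u , y≢u) = sur m (λ eq → contradiction eq x≢u) (λ _ eq → contradiction eq y≢u)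

-- Minimal realizations

-- Serves to collect the survival of all pairs of vertices, each known only up to double negation.
¬¬-Fin : ∀ {n} {P : Fin n → Set} → (∀ i → ¬ ¬ P i) → ¬ ¬ (∀ i → P i)
¬¬-Fin {zero}  nn k = k λ ()
¬¬-Fin {suc n} nn k = nn Fin.zero λ p → ¬¬-Fin (nn ∘ Fin.suc) λ ps →
  k λ { Fin.zero → p ; (Fin.suc i) → ps i }

module _ {n : ℕ} {s : Bool} {D : Rel n} {λ′ : Labeling n} (minimal : MinimalRealization s D λ′) where

  realizes : Realizes s D λ′
  realizes = proj₁ (proj₂ minimal)

  λ-sym : ∀ x y → λ′ x y ≡ λ′ y x
  λ-sym = proj₁ (proj₁ minimal)

  labelled-sym : ∀ {x y t} → t ∈ λ′ x y → t ∈ λ′ y x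
  labelled-sym {x} {y} {t} = subst (t ∈_) (λ-sym x y)

  labelled⇒≢ : ∀ {x y t} → t ∈ λ′ x y → x ≢ y
  labelled⇒≢ {x} {t = t} m refl with subst (t ∈_) (proj₂ (proj₂ (proj₁ minimal)) x) m
  ... | ()

  -- Without a witness in either direction, deleting `t` preserves all reachability, against
  -- minimality.
  critical : ∀ {u v} → u ≢ v → ∀ {t} → t ∈ λ′ u v →
    ¬ ¬ ((Σ (Critical λ′ s u v) λ i → Critical.label i ≡ t) ⊎ (Σ (Critical λ′ s v u) λ i → Critical.label i ≡ t))
  critical {u} {v} u≢v {t} t∈ none =
    ¬¬-Fin (λ a → ¬¬-Fin (λ b → keep a b)) λ all →
      proj₂ (proj₂ minimal) u v u≢v S
        ((λ r → proj₁ ∘ ∈-filter⁻ P?) , t , t∈ , λ t∈S → proj₂ (∈-filter⁻ P? {xs = λ′ u v} t∈S) refl)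
        λ a b → all a b ∘ proj₁ (realizes a b) , proj₂ (realizes a b) ∘ back
    where
    P? : Decidable (_≢ t)
    P? r = ¬? (r ≟ t)
    S = filter P? (λ′ u v)
    μ = Replace λ′ u v S
    sur : Survives λ′ s μ u v t
    sur m f g = ∈-Replace⁺ λ′ u v S m
      (λ { refl refl → ∈-filter⁺ P? m (f refl refl) })
      (λ { refl refl → ∈-filter⁺ P? (labelled-sym m) (g refl refl) })
    sur′ : Survives λ′ s μ v u t
    sur′ m f g = sur m g f
    back : ∀ {a b} → Reach μ s a b → Reach λ′ s a b
    back (a≢b , st , valid , _) = walk⇒reach a≢b
      (mapWalk (∈-Replace⁻ λ′ u v S (proj₁ ∘ ∈-filter⁻ P?) (λ-sym u v)) (proj₁ (proj₂ (steps⇒walk st valid))))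
    keep : ∀ a b → ¬ ¬ (Reach λ′ s a b → Reach μ s a b)
    keep a b k = k λ { (a≢b , st , valid , un) → contradiction (λ r → k λ _ → r) (lost a≢b st valid un) }
      where
      lost : a ≢ b → ∀ st → ValidSteps λ′ s a nothing st b → Unique (a ∷ map proj₁ st) → ¬ ¬ Reach μ s a b
      lost a≢b st valid un nr with steps⇒walk st valid
      ... | q , W , eq with split-or-survive λ′ s sur W
      ...   | inj₁ W′ = nr (walk⇒reach a≢b W′)
      ...   | inj₂ (inj₁ σ) = none (inj₁ (split⇒critical λ′ s sur W (subst Unique (sym eq) un) (nr ∘ walk⇒reach a≢b) σ))
      ...   | inj₂ (inj₂ σ) = none (inj₂ (split⇒critical λ′ s sur′ W (subst Unique (sym eq) un) (nr ∘ walk⇒reach a≢b) σ))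

  labelled⇒D : ∀ {x y t} → t ∈ λ′ x y → D x y
  labelled⇒D m = proj₂ (realizes _ _) (walk⇒reach (labelled⇒≢ m) (step m tt []))

  labelled⇒solid : ∀ {x y t} → t ∈ λ′ x y → Solid D x y
  labelled⇒solid m = labelled⇒D m , labelled⇒D (labelled-sym m)

  two-steps⇒D : ∀ {x y z t t′} → x ≢ z → t ∈ λ′ x y → TimeOk s (just t) t′ → t′ ∈ λ′ y z → D x z
  two-steps⇒D x≢z m ok m′ = proj₂ (realizes _ _) (walk⇒reach x≢z (step m tt (step m′ ok [])))

  -- Routes, late arcs and the arc chosen by a label

  module _ {u v : Fin n} where
    open Critical

    Front : TimedRel n
    Front = Within (Labelled λ′) (_≢ v)

    route : Critical λ′ s u v → List (Fin n × Fin n)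
    route i = (u , v) ∷ edges (front i)

    record Passage (i : Critical λ′ s u v) (p z : Fin n) : Set where
      field
        {arr}   : Maybe ℕ
        {dep}   : ℕ
        before  : Walk Front s (source i) nothing p arr
        onTime  : TimeOk s arr dep
        edge    : Via λ′ u v (label i) p z dep
        after   : Walk (Via λ′ u v (label i)) s z (just dep) v (just (label i))

    via⇒labelled : ∀ (i : Critical λ′ s u v) {x y t} → Via λ′ u v (label i) x y t → t ∈ λ′ x y
    via⇒labelled i (inj₁ (m , _))             = m
    via⇒labelled i (inj₂ (refl , refl , refl)) = labelled i

    passage : ∀ (i : Critical λ′ s u v) {p z} → (p , z) ∈ route i → Passage i p z
    passage i (here refl) = record
      { before = front i ; onTime = inTime i ; edge = inj₂ (refl , refl , refl) ; after = [] }
    passage i {p} {z} (there m) = locate [] (front i) m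
      where
      locate : ∀ {x r} → Walk Front s (source i) nothing x r →
        (W : Walk Front s x r u (arrival i)) → (p , z) ∈ edges W → Passage i p z
      locate done (step e ok W) (here refl) = record
        { before = done ; onTime = ok ; edge = inj₁ e
        ; after = mapWalk inj₁ W ++ʷ step (inj₂ (refl , refl , refl)) (inTime i) [] }
      locate done (step e ok W) (there m) = locate (done ++ʷ step e ok []) W m

    -- Otherwise the source of i could switch to the route of j at p and cross {u , v} earlier.
    misses : ∀ (i j : Critical λ′ s u v) {p z r} → label j < label i →
      Walk Front s (source i) nothing p r → (π : Passage j p z) → ¬ TimeOk s r (Passage.dep π)
    misses i j lt W π ok = noEarlier i lt (labelled j)
      (mapWalk inj₁ W ++ʷ step (Passage.edge π) ok (Passage.after π))

    module _ (xs : List (Critical λ′ s u v)) where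

      Below : Critical λ′ s u v → Fin n × Fin n → Critical λ′ s u v → Critical λ′ s u v → Set
      Below i g j k = label j < label k × label k < label i × g ∈ route j × g ∈ route k

      -- Quantifying over the list `xs` only makes lateness decidable.
      Late : Critical λ′ s u v → Fin n × Fin n → Set
      Late i g = Any (λ j → Any (Below i g j) xs) xs

      late? : ∀ i g → Dec (Late i g)
      late? i g = Any.any? (λ j → Any.any? (λ k →
        (label j <? label k) ×-dec (label k <? label i)
          ×-dec Any.any? (g ≟²_) (route j) ×-dec Any.any? (g ≟²_) (route k)) xs) xs

      late⁺ : ∀ {i g j k} → j ∈ xs → k ∈ xs → Below i g j k → Late i g
      late⁺ {i} {g} j∈ k∈ b =
        Any.map (λ { refl → Any.map (λ { refl → b }) k∈ }) j∈

      late⁻ : ∀ {i g} → Late i g → ∃ λ j → ∃ λ k → Below i g j k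
      late⁻ l with Any.satisfied l
      ... | j , l′ = j , Any.satisfied l′

      IsTriangle : Fin n × Fin n → Fin n → Set
      IsTriangle (w , p) z = Solid D w p × Solid D w z × Solid D p z

      -- z → p at the departure of the lowest route through (p , z), then p → w at the time
      -- at which the route of i, the highest of the three, traverses (w , p).
      late⇒triangle : ∀ (i : Critical λ′ s u v) {w p z t t′} →
        Walk Front s (source i) nothing p (just t) → t ∈ λ′ w p → t′ ∈ λ′ p z →
        TimeOk s (just t) t′ → w ≢ z → Late i (p , z) → IsTriangle (w , p) z
      late⇒triangle i {w} {p} {z} {t} W m m′ ok w≢z l with late⁻ {i} l
      ... | j , k , j<k , k<i , g∈j , g∈k =
        labelled⇒solid m ,
        (two-steps⇒D w≢z m ok m′ ,
         two-steps⇒D (≢-sym w≢z) (labelled-sym (via⇒labelled j (edge πj)))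
           (<⇒TimeOk s (<-≤-trans dep< dep≤)) (labelled-sym m)) ,
        labelled⇒solid m′
        where
        open Passage
        πj = passage j g∈j
        πk = passage k g∈k
        -- The walk of `i` reaches `p` too late to follow `k`. Likewise `k` reaches `p` too late to
        -- follow `j`, yet in time for its own departure.
        dep≤ : dep πk ≤ t
        dep≤ = ¬TimeOk⇒≥ s (misses i k k<i W πk)
        dep< : dep πj < dep πk
        dep< = ≰⇒> λ le → misses k j j<k (before πk) πj (TimeOk-≤ s (arr πk) (onTime πk) le)

      -- `edge` is the arc just before the first late arc of the route, or the crossing arc
      -- `(u , v)` if no arc is late.
      record Place (i : Critical λ′ s u v) : Set where
        field
          edge     : Fin n × Fin n
          apex     : Fin n
          onRoute  : edge ∈ route i
          notLate  : ¬ Late i edge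
          triangle : edge ≢ (u , v) → IsTriangle edge apex

      last-place : ∀ i → ¬ Late i (u , v) → Place i
      -- The apex is a default value: no triangle is claimed at the crossing arc.
      last-place i nl = record
        { edge = u , v ; apex = v ; onRoute = here refl ; notLate = nl
        ; triangle = λ ne → contradiction refl ne }

      -- Time `nothing` means that nothing has been traversed yet, so any departure is in time,
      -- including that of a lower route.
      first-not-late : ∀ i {p z} → Walk Front s (source i) nothing p nothing → ¬ Late i (p , z)
      first-not-late i W l with late⁻ {i} l
      ... | j , k , _ , k<i , _ , g∈k = misses i k k<i W (passage k g∈k) tt

      -- Scans the route with the invariant that `(w , p)` is not late. If the next arc is late, its
      -- head is the apex; otherwise the scan moves on.
      advance : ∀ i {w p r t} → Walk Front s (source i) nothing w r → Front w p t → TimeOk s r t →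
        (W : Walk Front s p (just t) u (arrival i)) → All (w ≢_) (verts W) →
        Unique (verts W) → (∀ {g} → g ∈ (w , p) ∷ edges W → g ∈ route i) → ¬ Late i (w , p) → Place i
      -- No front arc remains, so `p` is `u` and the next arc is the crossing arc.
      advance i done e@(m , w≢v , _) ok [] _ _ sub nl with late? i (u , v)
      ... | no nl′ = last-place i nl′
      ... | yes l = record
        { edge = _ ; apex = v ; onRoute = sub (here refl) ; notLate = nl
        ; triangle = λ _ → late⇒triangle i (done ++ʷ step e ok []) m (labelled i) (inTime i) w≢v l }
      advance i done e@(m , _) ok (step {x = p} {y = z} e′@(m′ , _) ok′ W) (_ ∷ w∉) (p∉ ∷ un) sub nl with late? i (p , z)
      ... | no nl′ = advance i (done ++ʷ step e ok []) e′ ok′ W p∉ un (sub ∘ there) nl′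
      ... | yes l = record
        { edge = _ ; apex = z ; onRoute = sub (here refl) ; notLate = nl
        ; triangle = λ _ → late⇒triangle i (done ++ʷ step e ok []) m m′ ok′ (All.lookup w∉ (start∈verts W)) l }

      -- The initial time is a variable with an equation because matching `[]` has to unify it with
      -- `arrival i`.
      start : ∀ i {x p} → Walk Front s (source i) nothing x p → p ≡ nothing →
        (W : Walk Front s x p u (arrival i)) → Unique (verts W) →
        (∀ {g} → g ∈ edges W → g ∈ route i) → Place i
      start i done eq [] _ _ = last-place i (first-not-late i (subst (Walk Front s (source i) nothing u) eq done))
      start i done refl (step e ok W) (x∉ ∷ un) sub = advance i done e ok W x∉ un sub (first-not-late i done)

      place : ∀ i → Place i
      place i = start i [] refl (front i) (simple i) there

      Distinct : Critical λ′ s u v → Critical λ′ s u v → Set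
      Distinct i j = label i ≢ label j

      -- Of three labels choosing the same arc, the two smaller ones would make it late for the
      -- largest.
      place-fibres : FibresBounded Distinct (_∈ xs) (Place.edge ∘ place) 2
      place-fibres g []          _ _ _ = z≤n
      place-fibres g (_ ∷ [])     _ _ _ = s≤s z≤n
      place-fibres g (_ ∷ _ ∷ []) _ _ _ = s≤s (s≤s z≤n)
      place-fibres g (a ∷ b ∷ c ∷ zs) ((ab ∷ ac ∷ _) ∷ (bc ∷ _) ∷ _) (a∈ ∷ b∈ ∷ c∈ ∷ _) (ga ∷ gb ∷ gc ∷ _)
        with three-ordered {P = λ i → i ∈ xs × Place.edge (place i) ≡ g} label (a∈ , ga) (b∈ , gb) (c∈ , gc) ab ac bc
      ... | j , k , i , (j∈ , gj) , (k∈ , gk) , (_ , gi) , j<k , k<i = contradiction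
        (late⁺ {i} j∈ k∈ (j<k , k<i , on gj , on gk))
        (subst (¬_ ∘ Late i) gi (Place.notLate (place i)))
        where
        on : ∀ {j} → Place.edge (place j) ≡ g → g ∈ route j
        on {j} refl = Place.onRoute (place j)

      -- At most two labels choose the crossing arc; all others choose an arc in a triangle, at most
      -- two per arc.
      critical-length : SimpleDigraph D → (F : List (Fin n × Fin n)) → Acyclic (RemoveEdges (Solid D) F) →
        AllPairs Distinct xs → length xs ≤ 2 + 2 * (10 * length F)
      critical-length simpleD F acyclic dist = length≤split atEnd? xs
        (place-fibres (u , v) _ (AllPairs.filter⁺ atEnd? dist)
          (All.filter⁺ atEnd? members) (All.all-filter atEnd? xs))
        (triangle-length Distinct (_∈ xs) (proj₁ ∘ edge) (proj₂ ∘ edge) (Place.apex ∘ place) place-fibres _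
          (AllPairs.filter⁺ (¬? ∘ atEnd?) dist)
          (All.map (λ { {i} (i∈ , ne) → i∈ , Place.triangle (place i) ne })
            (All.zip (All.filter⁺ (¬? ∘ atEnd?) members , All.all-filter (¬? ∘ atEnd?) xs))))
        where
        open Triangles (Solid D) swap (λ {x} d → simpleD x (proj₁ d)) F acyclic
        edge : Critical λ′ s u v → Fin n × Fin n
        edge = Place.edge ∘ place
        atEnd? : Decidable (λ i → edge i ≡ (u , v))
        atEnd? i = edge i ≟² (u , v)
        members : All (_∈ xs) xs
        members = All.tabulate id

-- Combining the two directions

module _ {A B : Set} (f : A → ℕ) (g : B → ℕ) where

  -- Only finitely many classical choices are made, so they can be made under one double negation.
  ¬¬-partition : ∀ L → Unique L → (∀ {t} → t ∈ L → ¬ ¬ ((∃ λ a → f a ≡ t) ⊎ (∃ λ b → g b ≡ t))) →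
    ¬ ¬ (∃ λ xs → ∃ λ ys → length L ≤ length xs + length ys
      × AllPairs (_≢_ on f) xs × AllPairs (_≢_ on g) ys
      × All (λ a → f a ∈ L) xs × All (λ b → g b ∈ L) ys)
  ¬¬-partition [] _ _ k = k ([] , [] , z≤n , [] , [] , [] , [])
  ¬¬-partition (t ∷ L) (t∉ ∷ un) choice k = choice (here refl) λ c → ¬¬-partition L un (choice ∘ there) (k ∘ extend c)
    where
    fresh : ∀ {r} → r ∈ L → t ≢ r
    fresh = All.lookup t∉
    extend : (∃ λ a → f a ≡ t) ⊎ (∃ λ b → g b ≡ t) → _ → _
    extend (inj₁ (a , refl)) (xs , ys , le , dx , dy , ix , iy) =
      a ∷ xs , ys , s≤s le , All.map fresh ix ∷ dx , dy , here refl ∷ All.map there ix , All.map there iy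
    extend (inj₂ (b , refl)) (xs , ys , le , dx , dy , ix , iy) =
      xs , b ∷ ys , ≤-trans (s≤s le) (≤-reflexive (sym (+-suc _ _))) ,
      dx , All.map fresh iy ∷ dy , All.map there ix , here refl ∷ All.map there iy

theorem37 : Σ ℕ λ c → (s : Bool) (n : ℕ) (D : Rel n) → SimpleDigraph D →
    (λ′ : Labeling n) → MinimalRealization s D λ′ →
    (k : ℕ) → IsFeedbackEdgeSetNumber (Solid D) k →
    (u v : Fin n) → length (λ′ u v) ≤ c * (k + 1)
theorem37 = 40 , bound
  where
  -- Each direction contributes `2 + 20 * k`; the slack 36 rounds `4 + 40 * k` up to `40 * (k + 1)`.
  arith : ∀ k → (2 + 2 * (10 * k)) + (2 + 2 * (10 * k)) + 36 ≡ 40 * (k + 1)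
  arith = solve-∀
  bound : (s : Bool) (n : ℕ) (D : Rel n) → SimpleDigraph D →
    (λ′ : Labeling n) → MinimalRealization s D λ′ →
    (k : ℕ) → IsFeedbackEdgeSetNumber (Solid D) k →
    (u v : Fin n) → length (λ′ u v) ≤ 40 * (k + 1)
  bound s n D simpleD λ′ minimal k ((F , refl , acyclic) , _) u v with u Fin.≟ v
  ... | yes refl rewrite proj₂ (proj₂ (proj₁ minimal)) u = z≤n
  -- The inequality is decidable, so the double negation can be discharged.
  ... | no u≢v = decidable-stable (length (λ′ u v) ≤? 40 * (length F + 1)) λ k →
    ¬¬-partition {Critical λ′ s u v} {Critical λ′ s v u} Critical.label Critical.label (λ′ u v)
      (proj₁ (proj₂ (proj₁ minimal)) u v) (critical minimal u≢v)
      λ { (xs , ys , le , dx , dy , _) → k (≤-trans le (≤-trans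
        (+-mono-≤ (critical-length minimal xs simpleD F acyclic dx) (critical-length minimal ys simpleD F acyclic dy))
        (≤-trans (m≤m+n _ 36) (≤-reflexive (arith (length F)))))) }
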